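{- Let $d\ge 0$ be an integer. A partial cube $G$ has VC-dimension $\le d$ if and only if each hyperplane $H_i$ of $G$ has VC-dimension $\le d-1$.
   Context: All graphs are finite, connected and simple (hyperplanes below may be disconnected). $Q_m$ has as vertices the subsets of $\{1,\dots,m\}$, adjacent iff their symmetric difference has size $1$. A partial cube is a graph $G$ isometrically (distance-preservingly) embeddable in a hypercube; we identify it with its image in $Q_m$ (with $m$ minimal), an induced subgraph of $Q_m$, hence with a set family. The VC-dimension of a nonempty set family $\mathcal S$ (or of an induced subgraph of a hypercube with vertex set $\mathcal S$) is the maximum size of a set $X$ with $\{X\cap S:S\in\mathcal S\}=2^X$. The $\Theta$-class $E_i$ of $G$ is the set of edges of $G$ whose endpoints differ in element $i$. The hyperplane $H_i$ of $E_i$ has the edges of $E_i$ as vertices, two being adjacent iff they belong to a common 4-cycle of $G$; equivalently, $H_i$ is the subgraph of the hypercube on subsets of $\{1,\dots,m\}\setminus\{i\}$ induced by the sets $S\not\ni i$ such that both $S$ and $S\cup\{i\}$ are vertices of $G$. Its VC-dimension is that of this set family. -}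

module Defs where

open import Data.Fin.Base using (Fin)
open import Data.Fin.Subset using (Subset; _∉_; _⊆_; _∩_; _∪_; _─_; ⁅_⁆; ∣_∣)
open import Data.Fin.Subset.Properties using (∪-comm)
open import Data.Integer.Base using (ℤ; +_) renaming (_≤_ to _≤ᶻ_)
open import Data.Nat.Base using (ℕ; suc; _≤_)
open import Data.Nat.Properties using (0≢1+n)
open import Data.Product.Base using (∃-syntax; _×_)
open import Data.Vec.Base using ([]; _∷_)
open import Data.Bool.Base using (true; false)
open import Function.Bundles using (_↔_; _⇔_)
open import Level using (0ℓ)
open import Relation.Binary.Core using (Rel)
open import Relation.Binary.Definitions using (Symmetric; Irreflexive)
open import Relation.Binary.PropositionalEquality using (_≡_; refl; sym; trans; cong)
open import Relation.Unary using (Pred; _≐_)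

record Graph : Set₁ where
  infix 4 _~_
  field
    Vertex   : Set
    _~_      : Rel Vertex 0ℓ
    ~-sym    : Symmetric _~_
    ~-irrefl : Irreflexive _≡_ _~_

open Graph public using (Vertex)

IsFinite : Graph → Set
IsFinite G = ∃[ n ] (Vertex G ↔ Fin n)

module _ (G : Graph) where
  open Graph G using (_~_)

  data Walk : Vertex G → Vertex G → ℕ → Set where
    []  : ∀ {u} → Walk u u 0
    _∷_ : ∀ {u v w k} → u ~ v → Walk v w k → Walk u w (suc k)

  IsDistance : Vertex G → Vertex G → ℕ → Set
  IsDistance u v k = Walk u v k × (∀ l → Walk u v l → k ≤ l)

  -- The empty graph is not connected.
  IsConnected : Set
  IsConnected = Vertex G × (∀ u v → ∃[ k ] Walk u v k)

IsIsometric : (G H : Graph) → (Vertex G → Vertex H) → Set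
IsIsometric G H φ = ∀ u v k → IsDistance G u v k ⇔ IsDistance H (φ u) (φ v) k

infixl 6 _△_

_△_ : ∀ {m} → Subset m → Subset m → Subset m
p △ q = (p ─ q) ∪ (q ─ p)

private
  ∣p△p∣≡0 : ∀ {m} (p : Subset m) → ∣ p △ p ∣ ≡ 0
  ∣p△p∣≡0 []          = refl
  ∣p△p∣≡0 (true  ∷ p) = ∣p△p∣≡0 p
  ∣p△p∣≡0 (false ∷ p) = ∣p△p∣≡0 p

Q : ℕ → Graph
Q m = record
  { Vertex   = Subset m
  ; _~_      = λ p q → ∣ p △ q ∣ ≡ 1
  ; ~-sym    = λ {p} {q} → trans (cong ∣_∣ (∪-comm (q ─ p) (p ─ q)))
  ; ~-irrefl = λ { {p} refl p~p → 0≢1+n (trans (sym (∣p△p∣≡0 p)) p~p) }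
  }

Family : ℕ → Set₁
Family m = Pred (Subset m) 0ℓ

trace : ∀ {m} → Family m → Subset m → Family m
trace 𝓢 X Y = ∃[ S ] 𝓢 S × X ∩ S ≡ Y

Shatters : ∀ {m} → Family m → Subset m → Set
Shatters 𝓢 X = trace 𝓢 X ≐ (_⊆ X)

IsVCdim : ∀ {m} → Family m → ℕ → Set
IsVCdim 𝓢 k = (∃[ X ] Shatters 𝓢 X × ∣ X ∣ ≡ k) × (∀ X → Shatters 𝓢 X → ∣ X ∣ ≤ k)

-- The bound is an integer so that it may be -1, which no family satisfies:
-- the empty family has no VC-dimension.
VCdim≤ : ∀ {m} → Family m → ℤ → Set
VCdim≤ 𝓢 z = ∃[ k ] IsVCdim 𝓢 k × + k ≤ᶻ z

record PartialCube : Set₁ where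
  field
    graph     : Graph
    finite    : IsFinite graph
    connected : IsConnected graph
    dim       : ℕ
    embed     : Vertex graph → Subset dim
    isometric : IsIsometric graph (Q dim) embed
    minimal   : ∀ k (ψ : Vertex graph → Subset k) → IsIsometric graph (Q k) ψ → dim ≤ k

  family : Family dim
  family S = ∃[ v ] embed v ≡ S

  -- A set S in the i-th hyperplane stands for the edge {S , S ∪ {i}} of the
  -- i-th Θ-class.  Such an S is a subset of the ground set minus i, but is kept
  -- as a subset of the whole ground set; no shattered set can contain i, so
  -- this does not affect the VC-dimension.
  hyperplane : Fin dim → Family dim
  hyperplane i S = i ∉ S × family S × family (S ∪ ⁅ i ⁆)

-- If 𝓗ᵢ shatters X then 𝓢 shatters X ∪ {i}. Conversely, if 𝓢 shatters X and i ∈ X, then for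
-- Y ⊆ X \ {i} a geodesic from a vertex S with trace Y to one with trace Y ∪ {i} crosses the
-- i-th Θ-class, and every vertex T on it satisfies S ∩ S′ ⊆ T ⊆ S ∪ S′, so the crossing edge
-- witnesses Y in the trace of 𝓗ᵢ on X \ {i}. Minimality of the embedding makes every 𝓗ᵢ nonempty.

module Submission where

open import Defs
open import Data.Bool.Base using (true; false)
open import Data.Bool.Properties using () renaming (_≟_ to _≟ᵇ_)
open import Data.Fin.Base using (Fin; zero; suc)
open import Data.Fin.Properties using (any?)
open import Data.Fin.Subset
  using (Subset; inside; outside; _∈_; _∉_; _⊆_; _∩_; _∪_; ⁅_⁆; ∣_∣; ⊥) renaming (_-_ to _∖_)
open import Data.Fin.Subset.Properties
open import Data.Integer.Base using (+_; _-_; 1ℤ; +≤+)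
open import Data.Nat.Base using (ℕ; zero; suc; _+_; _≤_; z≤n; s≤s; s≤s⁻¹)
open import Data.Nat.Properties
  using (≤-refl; ≤-reflexive; ≤-trans; ≤-antisym; +-suc; +-mono-≤; +-monoˡ-≤; +-monoʳ-≤; n≤1+n; m≤n⇒m≤1+n;
    m≤n⇒m<n∨m≡n; 1+n≰n; suc-injective)
  renaming (_≟_ to _≟ⁿ_)
open import Data.Product.Base using (_,_; _×_; ∃-syntax; proj₁; proj₂)
open import Data.Sum.Base using (inj₁; inj₂; [_,_]′)
open import Data.Vec.Base using ([]; _∷_; lookup; removeAt; here; there)
open import Data.Vec.Properties using (≡-dec; []=⇒lookup; lookup⇒[]=)
open import Function.Base using (_∘_)
open import Function.Bundles using (_⇔_; mk⇔; module Equivalence; module Inverse)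
open import Relation.Binary.Definitions using (DecidableEquality)
open import Relation.Binary.PropositionalEquality using (_≡_; refl; sym; trans; cong; subst)
open import Relation.Nullary using (Dec; yes; no; ¬_; ¬?; contradiction)
open import Relation.Nullary.Decidable using (map′; _×-dec_; decidable-stable)
open import Relation.Unary using (Decidable)

private variable
  m : ℕ

-- Equality and cardinality of subsets.

infix 4 _≟ˢ_

_≟ˢ_ : DecidableEquality (Subset m)
_≟ˢ_ = ≡-dec _≟ᵇ_

i∉p∖i : (p : Subset m) (i : Fin m) → i ∉ p ∖ i
i∉p∖i (_ ∷ p) zero    ()
i∉p∖i (_ ∷ p) (suc i) (there i∈) = i∉p∖i p i i∈

∣p∣≤1+∣p∖i∣ : (p : Subset m) (i : Fin m) → ∣ p ∣ ≤ suc ∣ p ∖ i ∣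
∣p∣≤1+∣p∖i∣ (true  ∷ p) zero    = ≤-reflexive (cong (suc ∘ ∣_∣) (sym (p─⊥≡p p)))
∣p∣≤1+∣p∖i∣ (false ∷ p) zero    = m≤n⇒m≤1+n (≤-reflexive (cong ∣_∣ (sym (p─⊥≡p p))))
∣p∣≤1+∣p∖i∣ (true  ∷ p) (suc i) = s≤s (∣p∣≤1+∣p∖i∣ p i)
∣p∣≤1+∣p∖i∣ (false ∷ p) (suc i) = ∣p∣≤1+∣p∖i∣ p i

i∉p⇒∣p∣<∣p∪⁅i⁆∣ : {p : Subset m} {i : Fin m} → i ∉ p → suc ∣ p ∣ ≤ ∣ p ∪ ⁅ i ⁆ ∣
i∉p⇒∣p∣<∣p∪⁅i⁆∣ {p = p} {i} i∉p =
  p⊂q⇒∣p∣<∣q∣ (p⊆p∪q ⁅ i ⁆ , i , q⊆p∪q p ⁅ i ⁆ (x∈⁅x⁆ i) , i∉p)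

-- The Hamming metric and its intervals.

∣p△p∣≡0 : (p : Subset m) → ∣ p △ p ∣ ≡ 0
∣p△p∣≡0 []          = refl
∣p△p∣≡0 (true  ∷ p) = ∣p△p∣≡0 p
∣p△p∣≡0 (false ∷ p) = ∣p△p∣≡0 p

∣p△q∣≡0⇒p≡q : (p q : Subset m) → ∣ p △ q ∣ ≡ 0 → p ≡ q
∣p△q∣≡0⇒p≡q []          []          _  = refl
∣p△q∣≡0⇒p≡q (true  ∷ p) (true  ∷ q) eq = cong (true ∷_) (∣p△q∣≡0⇒p≡q p q eq)
∣p△q∣≡0⇒p≡q (false ∷ p) (false ∷ q) eq = cong (false ∷_) (∣p△q∣≡0⇒p≡q p q eq)

s≤s-+-suc : ∀ {a b c} → c ≤ a + b → suc c ≤ a + suc b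
s≤s-+-suc {a} {b} c≤a+b = ≤-trans (s≤s c≤a+b) (≤-reflexive (sym (+-suc a b)))

s≤s⁻¹-+-suc : ∀ {a b c} → a + suc b ≤ suc c → a + b ≤ c
s≤s⁻¹-+-suc {a} {b} le = s≤s⁻¹ (≤-trans (≤-reflexive (sym (+-suc a b))) le)

∣△∣-triangle : (p q r : Subset m) → ∣ p △ r ∣ ≤ ∣ p △ q ∣ + ∣ q △ r ∣
∣△∣-triangle []          []          []          = z≤n
∣△∣-triangle (true  ∷ p) (true  ∷ q) (true  ∷ r) = ∣△∣-triangle p q r
∣△∣-triangle (true  ∷ p) (true  ∷ q) (false ∷ r) = s≤s-+-suc (∣△∣-triangle p q r)
-- Only the middle set differs here: the right side gains two and the left side nothing.
∣△∣-triangle (true  ∷ p) (false ∷ q) (true  ∷ r) =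
  m≤n⇒m≤1+n (≤-trans (∣△∣-triangle p q r) (+-monoʳ-≤ ∣ p △ q ∣ (n≤1+n ∣ q △ r ∣)))
∣△∣-triangle (true  ∷ p) (false ∷ q) (false ∷ r) = s≤s (∣△∣-triangle p q r)
∣△∣-triangle (false ∷ p) (true  ∷ q) (true  ∷ r) = s≤s (∣△∣-triangle p q r)
∣△∣-triangle (false ∷ p) (true  ∷ q) (false ∷ r) =
  m≤n⇒m≤1+n (≤-trans (∣△∣-triangle p q r) (+-monoʳ-≤ ∣ p △ q ∣ (n≤1+n ∣ q △ r ∣)))
∣△∣-triangle (false ∷ p) (false ∷ q) (true  ∷ r) = s≤s-+-suc (∣△∣-triangle p q r)
∣△∣-triangle (false ∷ p) (false ∷ q) (false ∷ r) = ∣△∣-triangle p q r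

-- This is membership of `q` in the metric interval of the hypercube from `p` to `r`: `q` agrees
-- with both wherever they agree.
Between : (p q r : Subset m) → Set
Between p q r = p ∩ r ⊆ q × q ⊆ p ∪ r

Between-left : (p r : Subset m) → Between p p r
Between-left p r = p∩q⊆p p r , p⊆p∪q r

-- This carries an interval found for the tail of a geodesic back to its first vertex.
Between-trans : (p q t r : Subset m) → Between p q r → Between q t r → Between p t r
Between-trans p q t r (pr⊆q , q⊆pr) (qr⊆t , t⊆qr) =
  (λ x∈ → qr⊆t (x∈p∩q⁺ (pr⊆q x∈ , p∩q⊆q p r x∈))) ,
  (λ x∈ → [ q⊆pr , q⊆p∪q p r ]′ (x∈p∪q⁻ q r (t⊆qr x∈)))

-- The triangle inequality holds coordinate by coordinate, so equality forces it in each one. A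
-- coordinate where `q` differs from both `p` and `r` would leave a slack of two.
∣△∣-tight⇒Between : (p q r : Subset m) → ∣ p △ q ∣ + ∣ q △ r ∣ ≤ ∣ p △ r ∣ → Between p q r
∣△∣-tight⇒Between [] [] [] _ = (λ ()) , (λ ())
∣△∣-tight⇒Between (true ∷ p) (true ∷ q) (true ∷ r) tight =
  let l , u = ∣△∣-tight⇒Between p q r tight in s⊆s l , s⊆s u
∣△∣-tight⇒Between (true ∷ p) (true ∷ q) (false ∷ r) tight =
  let l , u = ∣△∣-tight⇒Between p q r (s≤s⁻¹-+-suc tight) in out⊆ l , s⊆s u
∣△∣-tight⇒Between (true ∷ p) (false ∷ q) (true ∷ r) tight =
  contradiction (≤-trans tight (≤-trans (∣△∣-triangle p q r)
    (+-monoʳ-≤ ∣ p △ q ∣ (n≤1+n ∣ q △ r ∣)))) 1+n≰n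
∣△∣-tight⇒Between (true ∷ p) (false ∷ q) (false ∷ r) tight =
  let l , u = ∣△∣-tight⇒Between p q r (s≤s⁻¹ tight) in out⊆ l , out⊆ u
∣△∣-tight⇒Between (false ∷ p) (true ∷ q) (true ∷ r) tight =
  let l , u = ∣△∣-tight⇒Between p q r (s≤s⁻¹ tight) in out⊆ l , s⊆s u
∣△∣-tight⇒Between (false ∷ p) (true ∷ q) (false ∷ r) tight =
  contradiction (≤-trans tight (≤-trans (∣△∣-triangle p q r)
    (+-monoʳ-≤ ∣ p △ q ∣ (n≤1+n ∣ q △ r ∣)))) 1+n≰n
∣△∣-tight⇒Between (false ∷ p) (false ∷ q) (true ∷ r) tight =
  let l , u = ∣△∣-tight⇒Between p q r (s≤s⁻¹-+-suc tight) in out⊆ l , out⊆ u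
∣△∣-tight⇒Between (false ∷ p) (false ∷ q) (false ∷ r) tight =
  let l , u = ∣△∣-tight⇒Between p q r tight in s⊆s l , s⊆s u

-- The single disagreement has to be at `i`. If it occurred at an earlier coordinate, the tails
-- would coincide and could not disagree at `i`.
∣p△q∣≡1⇒q≡p∪⁅i⁆ : (p q : Subset m) (i : Fin m) → ∣ p △ q ∣ ≡ 1 → i ∉ p → i ∈ q → q ≡ p ∪ ⁅ i ⁆
∣p△q∣≡1⇒q≡p∪⁅i⁆ (true  ∷ p) (_ ∷ q) zero _ i∉p _ = contradiction here i∉p
∣p△q∣≡1⇒q≡p∪⁅i⁆ (false ∷ p) (true ∷ q) zero eq _ _
  rewrite ∪-identityʳ p = cong (true ∷_) (sym (∣p△q∣≡0⇒p≡q p q (suc-injective eq)))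
∣p△q∣≡1⇒q≡p∪⁅i⁆ (true ∷ p) (true ∷ q) (suc i) eq i∉p (there i∈q) =
  cong (true ∷_) (∣p△q∣≡1⇒q≡p∪⁅i⁆ p q i eq (i∉p ∘ there) i∈q)
∣p△q∣≡1⇒q≡p∪⁅i⁆ (false ∷ p) (false ∷ q) (suc i) eq i∉p (there i∈q) =
  cong (false ∷_) (∣p△q∣≡1⇒q≡p∪⁅i⁆ p q i eq (i∉p ∘ there) i∈q)
∣p△q∣≡1⇒q≡p∪⁅i⁆ (true ∷ p) (false ∷ q) (suc i) eq i∉p (there i∈q) =
  contradiction (there (subst (i ∈_) (sym (∣p△q∣≡0⇒p≡q p q (suc-injective eq))) i∈q)) i∉p
∣p△q∣≡1⇒q≡p∪⁅i⁆ (false ∷ p) (true ∷ q) (suc i) eq i∉p (there i∈q) =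
  contradiction (there (subst (i ∈_) (sym (∣p△q∣≡0⇒p≡q p q (suc-injective eq))) i∈q)) i∉p

-- A coordinate of agreement contributes nothing to the distance. This lets a constant coordinate be
-- dropped from an embedding.
∣△∣-removeAt : (p q : Subset (suc m)) (i : Fin (suc m)) → lookup p i ≡ lookup q i →
               ∣ removeAt p i △ removeAt q i ∣ ≡ ∣ p △ q ∣
∣△∣-removeAt (true  ∷ p) (true  ∷ q) zero _ = refl
∣△∣-removeAt (false ∷ p) (false ∷ q) zero _ = refl
∣△∣-removeAt (true  ∷ p@(_ ∷ _)) (true  ∷ q@(_ ∷ _)) (suc i) eq = ∣△∣-removeAt p q i eq
∣△∣-removeAt (true  ∷ p@(_ ∷ _)) (false ∷ q@(_ ∷ _)) (suc i) eq = cong suc (∣△∣-removeAt p q i eq)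
∣△∣-removeAt (false ∷ p@(_ ∷ _)) (true  ∷ q@(_ ∷ _)) (suc i) eq = cong suc (∣△∣-removeAt p q i eq)
∣△∣-removeAt (false ∷ p@(_ ∷ _)) (false ∷ q@(_ ∷ _)) (suc i) eq = ∣△∣-removeAt p q i eq

-- Geodesics of the hypercube.

Q-walk-∷ : ∀ s {p q : Subset m} {k} → Walk (Q m) p q k → Walk (Q (suc m)) (s ∷ p) (s ∷ q) k
Q-walk-∷ s     []      = []
Q-walk-∷ true  (e ∷ w) = e ∷ Q-walk-∷ true w
Q-walk-∷ false (e ∷ w) = e ∷ Q-walk-∷ false w

Q-geodesic : (p q : Subset m) → Walk (Q m) p q ∣ p △ q ∣
Q-geodesic []          []          = []
Q-geodesic (true  ∷ p) (true  ∷ q) = Q-walk-∷ true (Q-geodesic p q)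
-- The head is flipped first, with the tail `p` held fixed; the tail is corrected afterwards.
Q-geodesic (true  ∷ p) (false ∷ q) = cong suc (∣p△p∣≡0 p) ∷ Q-walk-∷ false (Q-geodesic p q)
Q-geodesic (false ∷ p) (true  ∷ q) = cong suc (∣p△p∣≡0 p) ∷ Q-walk-∷ true (Q-geodesic p q)
Q-geodesic (false ∷ p) (false ∷ q) = Q-walk-∷ false (Q-geodesic p q)

∣△∣≤length : {p q : Subset m} {k : ℕ} → Walk (Q m) p q k → ∣ p △ q ∣ ≤ k
∣△∣≤length {p = p} [] = ≤-reflexive (∣p△p∣≡0 p)
∣△∣≤length {p = p} {q} (_∷_ {v = v} e w) =
  ≤-trans (∣△∣-triangle p v q) (+-mono-≤ (≤-reflexive e) (∣△∣≤length w))

Q-distance : (p q : Subset m) → IsDistance (Q m) p q ∣ p △ q ∣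
Q-distance p q = Q-geodesic p q , λ _ → ∣△∣≤length

-- Isometric embeddings and minimality.

IsDistance-unique : ∀ (G : Graph) {u v k l} → IsDistance G u v k → IsDistance G u v l → k ≡ l
IsDistance-unique G (w , min) (w′ , min′) = ≤-antisym (min _ w′) (min′ _ w)

adjacent⇒distance1 : ∀ (G : Graph) {u v} → Graph._~_ G u v → IsDistance G u v 1
adjacent⇒distance1 G e = (e ∷ []) , λ where
  zero    []  → contradiction e (Graph.~-irrefl G refl)
  (suc _) _   → s≤s z≤n

-- Hypercube distance is the size of the symmetric difference and is unique, so isometry depends on
-- these numbers alone.
IsIsometric-respects-∣△∣ : ∀ (G : Graph) {k} (φ : Vertex G → Subset m) (ψ : Vertex G → Subset k) →
  (∀ u v → ∣ ψ u △ ψ v ∣ ≡ ∣ φ u △ φ v ∣) → IsIsometric G (Q m) φ → IsIsometric G (Q k) ψ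
IsIsometric-respects-∣△∣ G φ ψ eq iso u v k = mk⇔
  (λ d → subst (IsDistance (Q _) (ψ u) (ψ v))
    (trans (eq u v) (IsDistance-unique (Q _) (Q-distance (φ u) (φ v)) (to d)))
    (Q-distance (ψ u) (ψ v)))
  (λ d → from (subst (IsDistance (Q _) (φ u) (φ v))
    (trans (sym (eq u v)) (IsDistance-unique (Q _) (Q-distance (ψ u) (ψ v)) d))
    (Q-distance (φ u) (φ v))))
  where open Equivalence (iso u v k)

-- Deleting a constant coordinate would give an isometric embedding into a cube of one dimension
-- less.
minimal⇒¬constant : ∀ (G : Graph) (φ : Vertex G → Subset m) → IsIsometric G (Q m) φ →
  (∀ k (ψ : Vertex G → Subset k) → IsIsometric G (Q k) ψ → m ≤ k) →
  (i : Fin m) → ¬ (∀ u v → lookup (φ u) i ≡ lookup (φ v) i)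
minimal⇒¬constant {suc m} G φ iso min i const =
  1+n≰n (min m ψ (IsIsometric-respects-∣△∣ G φ ψ (λ u v → ∣△∣-removeAt (φ u) (φ v) i (const u v)) iso))
  where
  ψ : Vertex G → Subset m
  ψ v = removeAt (φ v) i

-- Shattering and the existence of the VC-dimension.

⊥-shattered : {𝓢 : Family m} → ∃[ S ] 𝓢 S → Shatters 𝓢 ⊥
⊥-shattered (S , S∈𝓢) =
  (λ { (T , _ , refl) → p∩q⊆p ⊥ T }) ,
  (λ Y⊆⊥ → S , S∈𝓢 , trans (∩-zeroˡ S) (⊆-antisym ⊥⊆ Y⊆⊥))

module _ {𝓢 : Family m} (𝓢? : Decidable 𝓢) where

  trace? : ∀ X → Decidable (trace 𝓢 X)
  trace? X Y = anySubset? (λ S → 𝓢? S ×-dec (X ∩ S ≟ˢ Y))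

  -- A finite search looks for a subset of `X` that is missed; if there is none, decidability of the
  -- trace removes the double negation.
  shatters? : Decidable (Shatters 𝓢)
  shatters? X with anySubset? (λ Y → (Y ⊆? X) ×-dec ¬? (trace? X Y))
  ... | yes (Y , Y⊆X , ¬t) = no λ sh → ¬t (proj₂ sh Y⊆X)
  ... | no  ¬∃ = yes
    ( (λ { (S , _ , refl) → p∩q⊆p X S })
    , λ {Y} Y⊆X → decidable-stable (trace? X Y) (λ ¬t → ¬∃ (Y , (λ {x} → Y⊆X {x}) , ¬t)))

  -- A VC-dimension must be attained, so an upper bound alone does not give one. The bound is
  -- lowered until some shattered set meets it; at zero, nonemptiness lets `⊥` do so.
  bounded⇒VCdim : ∃[ S ] 𝓢 S → ∀ b → (∀ X → Shatters 𝓢 X → ∣ X ∣ ≤ b) →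
                  ∃[ k ] IsVCdim 𝓢 k × k ≤ b
  bounded⇒VCdim ne zero    bound = 0 , ((⊥ , ⊥-shattered ne , ∣⊥∣≡0 m) , bound) , z≤n
  bounded⇒VCdim ne (suc b) bound with anySubset? (λ X → shatters? X ×-dec (∣ X ∣ ≟ⁿ suc b))
  ... | yes max = suc b , (max , bound) , ≤-refl
  ... | no ¬max = let k , vc , k≤b = bounded⇒VCdim ne b bound′ in k , vc , m≤n⇒m≤1+n k≤b
    where
    bound′ : ∀ X → Shatters 𝓢 X → ∣ X ∣ ≤ b
    bound′ X sh with m≤n⇒m<n∨m≡n (bound X sh)
    ... | inj₁ ∣X∣<1+b = s≤s⁻¹ ∣X∣<1+b
    ... | inj₂ ∣X∣≡1+b = contradiction (X , sh , ∣X∣≡1+b) ¬max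

  bounded⇒VCdim≤ : ∃[ S ] 𝓢 S → ∀ {b} → (∀ X → Shatters 𝓢 X → ∣ X ∣ ≤ b) → VCdim≤ 𝓢 (+ b)
  bounded⇒VCdim≤ ne bound = let k , vc , k≤b = bounded⇒VCdim ne _ bound in k , vc , +≤+ k≤b

VCdim≤⇒bounded : {𝓢 : Family m} {b : ℕ} → VCdim≤ 𝓢 (+ b) → ∀ X → Shatters 𝓢 X → ∣ X ∣ ≤ b
VCdim≤⇒bounded (k , (_ , bound) , +≤+ k≤b) X sh = ≤-trans (bound X sh) k≤b

-- Geodesics of a partial cube across a Θ-class.

module _ (𝓖 : PartialCube) where
  open PartialCube 𝓖

  ~⇒∣△∣≡1 : ∀ {u v} → Graph._~_ graph u v → ∣ embed u △ embed v ∣ ≡ 1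
  ~⇒∣△∣≡1 {u} {v} e = IsDistance-unique (Q dim) (Q-distance (embed u) (embed v))
    (Equivalence.to (isometric u v 1) (adjacent⇒distance1 graph e))

  embed-walk : ∀ {u v k} → Walk graph u v k → Walk (Q dim) (embed u) (embed v) k
  embed-walk []      = []
  embed-walk (e ∷ w) = ~⇒∣△∣≡1 e ∷ embed-walk w

  -- The walk is followed to its first edge that enters `i`, whose lower end is `T`. The length
  -- bound makes the walk shortest in the hypercube and passes to its tails, which keeps `T` in the
  -- interval.
  geodesic-crosses : ∀ {i u v k} → Walk graph u v k → k ≤ ∣ embed u △ embed v ∣ →
    i ∉ embed u → i ∈ embed v → ∃[ T ] hyperplane i T × Between (embed u) T (embed v)
  geodesic-crosses [] _ i∉u i∈u = contradiction i∈u i∉u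
  geodesic-crosses {i} {u} {v} (_∷_ {v = x} {k = k} e w) geo i∉u i∈v with i ∈? embed x
  ... | yes i∈x = embed u
    , (i∉u , (u , refl) , x , ∣p△q∣≡1⇒q≡p∪⁅i⁆ (embed u) (embed x) i (~⇒∣△∣≡1 e) i∉u i∈x)
    , Between-left (embed u) (embed v)
  ... | no  i∉x = let T , T∈H , bt = geodesic-crosses w geo′ i∉x i∈v in
    T , T∈H , Between-trans (embed u) (embed x) T (embed v)
      (∣△∣-tight⇒Between (embed u) (embed x) (embed v) tight) bt
    where
    geo′ : k ≤ ∣ embed x △ embed v ∣
    geo′ = s≤s⁻¹ (≤-trans geo (≤-trans (∣△∣-triangle (embed u) (embed x) (embed v))
      (+-monoˡ-≤ _ (≤-reflexive (~⇒∣△∣≡1 e)))))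
    tight : ∣ embed u △ embed x ∣ + ∣ embed x △ embed v ∣ ≤ ∣ embed u △ embed v ∣
    tight = ≤-trans (+-mono-≤ (≤-reflexive (~⇒∣△∣≡1 e)) (∣△∣≤length (embed-walk w))) geo

  -- Isometry pulls the Hamming distance back to `graph`, which yields a walk of exactly that length
  -- through vertices of `graph`.
  crossing : ∀ {i S S′} → family S → family S′ → i ∉ S → i ∈ S′ →
             ∃[ T ] hyperplane i T × Between S T S′
  crossing (u , refl) (v , refl) = geodesic-crosses
    (proj₁ (Equivalence.from (isometric u v _) (Q-distance (embed u) (embed v)))) ≤-refl

  -- Decidability from finiteness, and nonempty hyperplanes.

  anyVertex? : {P : Vertex graph → Set} → Decidable P → Dec (∃[ v ] P v)
  anyVertex? {P} P? = map′
    (λ (k , Pk) → from k , Pk)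
    (λ (v , Pv) → to v , subst P (sym (strictlyInverseʳ v)) Pv)
    (any? (P? ∘ from))
    where open Inverse (proj₂ finite)

  family? : Decidable family
  family? S = anyVertex? (λ v → embed v ≟ˢ S)

  hyperplane? : ∀ i → Decidable (hyperplane i)
  hyperplane? i S = ¬? (i ∈? S) ×-dec family? S ×-dec family? (S ∪ ⁅ i ⁆)

  origin : Vertex graph
  origin = proj₁ connected

  family-nonempty : ∃[ S ] family S
  family-nonempty = embed origin , origin , refl

  -- By minimality coordinate `i` is not constant, so vertices exist on both sides of the Θ-class,
  -- and a geodesic joining them crosses it.
  hyperplane-nonempty : ∀ i → ∃[ S ] hyperplane i S
  hyperplane-nonempty i with anyVertex? (λ v → i ∈? embed v) | anyVertex? (λ v → ¬? (i ∈? embed v))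
  ... | yes (v , i∈v) | yes (u , i∉u) =
    let T , T∈H , _ = crossing (u , refl) (v , refl) i∉u i∈v in T , T∈H
  ... | no  none | _ = contradiction
    (λ u v → trans (outside-at u) (sym (outside-at v)))
    (minimal⇒¬constant graph embed isometric minimal i)
    where
    outside-at : ∀ v → lookup (embed v) i ≡ outside
    outside-at v with lookup (embed v) i in eq
    ... | inside  = contradiction (v , lookup⇒[]= i (embed v) eq) none
    ... | outside = refl
  ... | _ | no none = contradiction
    (λ u v → trans (inside-at u) (sym (inside-at v)))
    (minimal⇒¬constant graph embed isometric minimal i)
    where
    inside-at : ∀ v → lookup (embed v) i ≡ inside
    inside-at v = []=⇒lookup (decidable-stable (i ∈? embed v) (λ i∉v → none (v , i∉v)))

  -- Transfer of shattered sets between a hyperplane and the family.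

  module _ {i : Fin dim} {X : Subset dim} where

    -- Realising the full trace `X` takes a member that contains `X`, and no member of the
    -- hyperplane contains `i`.
    hyperplane-shatters⇒∉ : Shatters (hyperplane i) X → i ∉ X
    hyperplane-shatters⇒∉ (_ , sh) i∈X with sh ⊆-refl
    ... | T , (i∉T , _) , X∩T≡X = i∉T (p∩q⊆q X T (subst (i ∈_) (sym X∩T≡X) i∈X))

    hyperplane-shatters⇒family-shatters : Shatters (hyperplane i) X → Shatters family (X ∪ ⁅ i ⁆)
    hyperplane-shatters⇒family-shatters (_ , sh) =
      (λ { (S , _ , refl) → p∩q⊆p (X ∪ ⁅ i ⁆) S }) , realise
      where
      realise : ∀ {Y} → Y ⊆ X ∪ ⁅ i ⁆ → trace family (X ∪ ⁅ i ⁆) Y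
      -- The edge at `T` realises `Y ∖ i` on `X`; its upper or lower end realises `Y`, according to
      -- whether `i ∈ Y`.
      realise {Y} Y⊆ with sh Y∖i⊆X
        where
        Y∖i⊆X : Y ∖ i ⊆ X
        Y∖i⊆X {j} j∈ with x∈p∪q⁻ X ⁅ i ⁆ (Y⊆ (p─q⊆p Y ⁅ i ⁆ j∈))
        ... | inj₁ j∈X = j∈X
        ... | inj₂ j∈i rewrite x∈⁅y⁆⇒x≡y i j∈i = contradiction j∈ (i∉p∖i Y i)
      ... | T , (i∉T , T∈ , T∪i∈) , X∩T≡Y∖i with i ∈? Y
      ...   | yes i∈Y = T ∪ ⁅ i ⁆ , T∪i∈ , trans (sym (∪-distribʳ-∩ ⁅ i ⁆ X T))
                (trans (cong (_∪ ⁅ i ⁆) X∩T≡Y∖i) (⊆-antisym ⊆Y Y⊆′))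
        where
        ⊆Y : (Y ∖ i) ∪ ⁅ i ⁆ ⊆ Y
        ⊆Y j∈ with x∈p∪q⁻ (Y ∖ i) ⁅ i ⁆ j∈
        ... | inj₁ j∈Y = p─q⊆p Y ⁅ i ⁆ j∈Y
        ... | inj₂ j∈i rewrite x∈⁅y⁆⇒x≡y i j∈i = i∈Y
        Y⊆′ : Y ⊆ (Y ∖ i) ∪ ⁅ i ⁆
        Y⊆′ {j} j∈Y with j ∈? ⁅ i ⁆
        ... | yes j∈i = q⊆p∪q (Y ∖ i) ⁅ i ⁆ j∈i
        ... | no  j∉i = p⊆p∪q ⁅ i ⁆ (x∈p∧x∉q⇒x∈p─q j∈Y j∉i)
      ...   | no  i∉Y = T , T∈ , ⊆-antisym ⊆Y Y⊆′
        where
        ⊆Y : (X ∪ ⁅ i ⁆) ∩ T ⊆ Y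
        ⊆Y {j} j∈ with x∈p∩q⁻ (X ∪ ⁅ i ⁆) T j∈
        ... | j∈X∪i , j∈T with x∈p∪q⁻ X ⁅ i ⁆ j∈X∪i
        ...   | inj₁ j∈X = p─q⊆p Y ⁅ i ⁆ (subst (j ∈_) X∩T≡Y∖i (x∈p∩q⁺ (j∈X , j∈T)))
        ...   | inj₂ j∈i rewrite x∈⁅y⁆⇒x≡y i j∈i = contradiction j∈T i∉T
        Y⊆′ : Y ⊆ (X ∪ ⁅ i ⁆) ∩ T
        Y⊆′ {j} j∈Y = x∈p∩q⁺ (Y⊆ j∈Y , p∩q⊆q X T (subst (j ∈_) (sym X∩T≡Y∖i) j∈Y∖i))
          where
          j∈Y∖i : j ∈ Y ∖ i
          j∈Y∖i = x∈p∧x≢y⇒x∈p-y j∈Y λ { refl → i∉Y j∈Y }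

    family-shatters⇒hyperplane-shatters : i ∈ X → Shatters family X → Shatters (hyperplane i) (X ∖ i)
    family-shatters⇒hyperplane-shatters i∈X (_ , sh) =
      (λ { (S , _ , refl) → p∩q⊆p (X ∖ i) S }) , realise
      where
      realise : ∀ {Y} → Y ⊆ X ∖ i → trace (hyperplane i) (X ∖ i) Y
      -- `S` and `S′` have traces `Y` and `Y ∪ ⁅ i ⁆` on `X`, hence the same trace on `X ∖ i`, and
      -- every set between them shares it.
      realise {Y} Y⊆ with sh (p─q⊆p X ⁅ i ⁆ ∘ Y⊆) | sh Y∪i⊆X
        where
        Y∪i⊆X : Y ∪ ⁅ i ⁆ ⊆ X
        Y∪i⊆X j∈ with x∈p∪q⁻ Y ⁅ i ⁆ j∈
        ... | inj₁ j∈Y = p─q⊆p X ⁅ i ⁆ (Y⊆ j∈Y)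
        ... | inj₂ j∈i rewrite x∈⁅y⁆⇒x≡y i j∈i = i∈X
      ... | S , S∈ , X∩S≡Y | S′ , S′∈ , X∩S′≡Y∪i = T , T∈H , ⊆-antisym ⊆Y Y⊆′
        where
        Y⊆S : Y ⊆ S
        Y⊆S {j} j∈Y = p∩q⊆q X S (subst (j ∈_) (sym X∩S≡Y) j∈Y)
        Y∪i⊆S′ : Y ∪ ⁅ i ⁆ ⊆ S′
        Y∪i⊆S′ {j} j∈ = p∩q⊆q X S′ (subst (j ∈_) (sym X∩S′≡Y∪i) j∈)
        i∉S : i ∉ S
        i∉S i∈S = i∉p∖i X i (Y⊆ (subst (i ∈_) X∩S≡Y (x∈p∩q⁺ (i∈X , i∈S))))
        cross : ∃[ T ] hyperplane i T × Between S T S′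
        cross = crossing S∈ S′∈ i∉S (Y∪i⊆S′ (q⊆p∪q Y ⁅ i ⁆ (x∈⁅x⁆ i)))
        T : Subset dim
        T = proj₁ cross
        T∈H : hyperplane i T
        T∈H = proj₁ (proj₂ cross)
        ⊆Y : (X ∖ i) ∩ T ⊆ Y
        ⊆Y {j} j∈ with x∈p∩q⁻ (X ∖ i) T j∈
        -- The upper end of the interval, `T ⊆ S ∪ S′`, prevents extra elements in the trace.
        ... | j∈X∖i , j∈T with x∈p∪q⁻ S S′ (proj₂ (proj₂ (proj₂ cross)) j∈T)
        ...   | inj₁ j∈S  = subst (j ∈_) X∩S≡Y (x∈p∩q⁺ (p─q⊆p X ⁅ i ⁆ j∈X∖i , j∈S))
        ...   | inj₂ j∈S′ with x∈p∪q⁻ Y ⁅ i ⁆ (subst (j ∈_) X∩S′≡Y∪i (x∈p∩q⁺ (p─q⊆p X ⁅ i ⁆ j∈X∖i , j∈S′)))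
        ...     | inj₁ j∈Y = j∈Y
        ...     | inj₂ j∈i rewrite x∈⁅y⁆⇒x≡y i j∈i = contradiction j∈X∖i (i∉p∖i X i)
        Y⊆′ : Y ⊆ (X ∖ i) ∩ T
        -- The lower end, `S ∩ S′ ⊆ T`, keeps all of `Y`.
        Y⊆′ j∈Y = x∈p∩q⁺ (Y⊆ j∈Y ,
          proj₁ (proj₂ (proj₂ cross)) (x∈p∩q⁺ (Y⊆S j∈Y , Y∪i⊆S′ (p⊆p∪q ⁅ i ⁆ j∈Y))))

  -- The two bounds and the equivalence.

  hyperplane-bounded : ∀ {d} → VCdim≤ family (+ d) →
    ∀ i X → Shatters (hyperplane i) X → suc ∣ X ∣ ≤ d
  hyperplane-bounded vc i X sh = ≤-trans (i∉p⇒∣p∣<∣p∪⁅i⁆∣ (hyperplane-shatters⇒∉ sh))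
    (VCdim≤⇒bounded vc (X ∪ ⁅ i ⁆) (hyperplane-shatters⇒family-shatters sh))

  hyperplane-VCdim≤ : ∀ d → VCdim≤ family (+ d) → ∀ i → VCdim≤ (hyperplane i) (+ d - 1ℤ)
  -- The target bound is -1, which no family meets, so the index `i` itself is refuted: its nonempty
  -- hyperplane shatters `⊥`, giving `1 ≤ 0`.
  hyperplane-VCdim≤ zero    vc i =
    contradiction (hyperplane-bounded vc i ⊥ (⊥-shattered (hyperplane-nonempty i))) λ ()
  hyperplane-VCdim≤ (suc d) vc i = bounded⇒VCdim≤ (hyperplane? i) (hyperplane-nonempty i)
    (λ X sh → s≤s⁻¹ (hyperplane-bounded vc i X sh))

  -- The form `suc ∣ X ∣ ≤ d` avoids the integer subtraction. For `d` zero the hypothesis is absurd,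
  -- as no natural number is at most -1.
  hyperplane-VCdim≤⇒bounded : ∀ d {i} → VCdim≤ (hyperplane i) (+ d - 1ℤ) →
    ∀ X → Shatters (hyperplane i) X → suc ∣ X ∣ ≤ d
  hyperplane-VCdim≤⇒bounded zero    (_ , _ , ())
  hyperplane-VCdim≤⇒bounded (suc d) vc X sh = s≤s (VCdim≤⇒bounded vc X sh)

  family-bounded : ∀ d → (∀ i → VCdim≤ (hyperplane i) (+ d - 1ℤ)) →
    ∀ X → Shatters family X → ∣ X ∣ ≤ d
  family-bounded d vc X sh with nonempty? X
  ... | yes (i , i∈X) = ≤-trans (∣p∣≤1+∣p∖i∣ X i)
    (hyperplane-VCdim≤⇒bounded d (vc i) (X ∖ i) (family-shatters⇒hyperplane-shatters i∈X sh))
  -- An empty `X` offers no `i` to pick; this also covers `dim` zero, where there are no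
  -- hyperplanes.
  ... | no  empty rewrite Empty-unique empty | ∣⊥∣≡0 dim = z≤n

proposition6 : (d : ℕ) (G : PartialCube) →
    VCdim≤ (PartialCube.family G) (+ d) ⇔
    (∀ i → VCdim≤ (PartialCube.hyperplane G i) (+ d - 1ℤ))
proposition6 d G = mk⇔
  (hyperplane-VCdim≤ G d)
  (λ vc → bounded⇒VCdim≤ (family? G) (family-nonempty G) (family-bounded G d vc))
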